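{- Let $u=123765948\in S_9$ (one-line notation) and $\beta=(4,4,4,4,1,0,0,0,0)$. Then $\#\mathsf{GKKoh}(u,\beta)=2$ and $\#\mathrm{PD}(u,\beta)=3$.
   Context: Cells of the $n\times n$ grid $[n]\times[n]$ are indexed in matrix notation: $(i,j)$ is row $i$ (counted from the top), column $j$ (counted from the left). Pipe dreams. A pipe dream is a filling of the triangular grid $\{(i,j)\in[n]\times[n]: i+j\leq n\}$ with crossing tiles (a pipe entering from the top exits at the bottom, a pipe entering from the right exits at the left) and bump tiles (a pipe entering from the top exits at the left, a pipe entering from the right exits at the bottom); half-bump tiles (a pipe entering from the top exits at the left) are placed on the antidiagonal $i+j=n+1$. This gives $n$ pipes running from the top edge to the left edge. The permutation of a pipe dream: label the pipes $1,\dots,n$ along the top edge from left to right, trace them downwards and leftwards, ignoring any crossing between two pipes that have already crossed (treat such crossing tiles as bump tiles); the permutation $w$ is given by reading the labels along the left edge from top to bottom, as $w(1)w(2)\cdots w(n)$. (Equivalently, $w$ is the Demazure (0-Hecke) product of the $s_{i+j-1}$ over the crossing tiles $(i,j)$, read row by row from top to bottom and right to left within each row.) $\mathrm{PD}(w)$ is the set of pipe dreams with permutation $w$; $\mathrm{wt}(P)_i$ is the number of crossing tiles in row $i$ of $P$; $\mathrm{PD}(w,\alpha)=\{P\in\mathrm{PD}(w):\mathrm{wt}(P)=\alpha\}$. Rothe diagram. For $w\in S_n$, $D(w)=\{(i,j)\in[n]^2: i<w^{ -1}(j),\ j<w(i)\}$. Grave diagrams and moves. A grave diagram is a pair $E=(B,G)$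 of disjoint subsets of $[n]\times[n]$; cells of $B$ are boxes, cells of $G$ are ghosts, cells of $B\cup G$ are occupied. Its weight is $\mathrm{wt}(E)_i=\#\{j:(i,j)\in B\cup G\}$. (a) Suppose $(i,j)\in B$ is rightmost among all occupied cells in row $i$; let $i'=\max\{r: 1\leq r<i,\ (r,j)\notin B\cup G\}$; assume $i'$ exists and every occupied cell $(r,j)$ with $i'<r\leq i$ is a box. The ordinary Kohnert move at row $i$ is $(B,G)\mapsto((B\setminus\{(i,j)\})\cup\{(i',j)\},G)$. The $K$-Kohnert move at row $i$ is $(B,G)\mapsto((B\setminus\{(i,j)\})\cup\{(i',j)\},G\cup\{(i,j)\})$. (b) Suppose $(i,j)\in G$ is the rightmost occupied cell in row $i$; let $i'=\max\{r: 1\leq r<i,\ (r,j)\notin B\cup G\}$; assume $i'$ exists and every occupied cell $(r,j)$ with $i'<r<i$ is a ghost. The ghost Kohnert move at row $i$ is $(B,G)\mapsto(B,(G\setminus\{(i,j)\})\cup\{(i',j)\})$. The ghost $K$-Kohnert move at row $i$ is $(B,G)\mapsto(B,G\cup\{(i',j)\})$. $\mathsf{GKKoh}(w)$ is the closure of $(D(w),\varnothing)$ under ordinary, $K$-, ghost, and ghost $K$-Kohnert moves, i.e. the set of all grave diagrams obtainable from $(D(w),\varnothing)$ by finite sequences of such moves, and $\mathsf{GKKoh}(w,\alpha)=\{E\in\mathsf{GKKoh}(w):\mathrm{wt}(E)=\alpha\}$. -}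

module Defs where

open import Data.Fin.Base using (Fin; _≤_; _<_)
open import Data.Fin.Patterns using (0F; 1F; 2F; 3F; 4F; 5F; 6F; 7F; 8F)
open import Data.Fin.Permutation using (Permutation′; permutation; _⟨$⟩ʳ_; _⟨$⟩ˡ_)
open import Data.Fin.Properties using (_≟_; _<?_; all?)
open import Data.Fin.Subset using (Subset; ⊥; ⁅_⁆; _∈_; _∪_; _-_; ∣_∣)
open import Data.Fin.Subset.Properties using (∉⊥)
open import Data.List.Base using (List; []; _∷_)
open import Data.List.Relation.Unary.Any using (Any; any?)
open import Data.Nat.Base using (ℕ; zero; suc)
open import Data.Product.Base using (Σ-syntax; _×_; _,_)
open import Data.Product.Properties using (≡-dec)
open import Data.Sum.Base using (_⊎_)
open import Data.Vec.Base using (Vec; []; _∷_; lookup; tabulate; replicate; allFin; count; _[_]%=_)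
open import Data.Vec.Membership.Propositional using () renaming (_∈_ to _∈ᵥ_)
open import Data.Vec.Properties using (lookup-replicate)
open import Data.Vec.Relation.Unary.Unique.Propositional using (Unique)
open import Function.Bundles using (_⇔_)
open import Relation.Binary.Construct.Closure.ReflexiveTransitive using (Star)
open import Relation.Binary.PropositionalEquality using (_≡_; subst)
open import Relation.Nullary using (¬_; Dec; yes; no; does)
open import Relation.Nullary.Decidable using (toWitness; _×-dec_; _⊎-dec_)

-- Rows, columns, pipe labels and the values of a permutation are all numbered
-- from 0: the usual 1, …, n become 0, …, n - 1.

-- The number of x : A that satisfy P; proofs of P are not counted.
HasCardinality : {A : Set} → (A → Set) → ℕ → Set
HasCardinality {A} P k =
  Σ[ xs ∈ Vec A k ] Unique xs × (∀ x → (x ∈ᵥ xs) ⇔ P x)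

data Tile : Set where
  cross bump : Tile

data IsCross : Tile → Set where
  isCross : IsCross cross

isCross? : (t : Tile) → Dec (IsCross t)
isCross? cross = yes isCross
isCross? bump  = no λ ()

-- Listed from the top row down, each row from left to right.  Row i
-- (counted from 1) of the triangle i + j ≤ n has n - i tiles; the half-bump
-- tile that ends each row is forced and is not recorded.
data PipeDream : ℕ → Set where
  []  : PipeDream zero
  _∷_ : ∀ {n} → Vec Tile n → PipeDream n → PipeDream (suc n)

wtPD : ∀ {n} → PipeDream n → Vec ℕ n
wtPD []      = []
wtPD (r ∷ P) = count isCross? r ∷ wtPD P

Crossings : ℕ → Set
Crossings N = List (Fin N × Fin N)

HaveCrossed : ∀ {N} → Crossings N → Fin N → Fin N → Set
HaveCrossed C p q = Any (λ c → c ≡ (p , q) ⊎ c ≡ (q , p)) C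

haveCrossed? : ∀ {N} (C : Crossings N) (p q : Fin N) → Dec (HaveCrossed C p q)
haveCrossed? C p q =
  any? (λ c → ≡-dec _≟_ _≟_ c (p , q) ⊎-dec ≡-dec _≟_ _≟_ c (q , p)) C

-- traceTile x t r C: pipe t enters from the top and pipe r from the right;
-- the result is (pipe leaving at the left , pipe leaving at the bottom , C′).
traceTile : ∀ {N} → Tile → Fin N → Fin N → Crossings N → Fin N × Fin N × Crossings N
traceTile bump  t r C = t , r , C
traceTile cross t r C with haveCrossed? C t r
... | yes _ = t , r , C
... | no  _ = r , t , (t , r) ∷ C

-- Traces one row from right to left, starting at its half-bump tile: from the
-- pipes entering at the top, computes the pipe leaving at the left edge and
-- those leaving at the bottom.
traceRow : ∀ {N m} → Vec Tile m → Vec (Fin N) (suc m) → Crossings N →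
           Fin N × Vec (Fin N) m × Crossings N
traceRow []       (t ∷ []) C = t , [] , C
traceRow (x ∷ xs) (t ∷ ts) C =
  let r , ds , C′  = traceRow xs ts C
      l , d  , C″  = traceTile x t r C′
  in  l , d ∷ ds , C″

-- The labels of the pipes along the left edge, from top to bottom.
trace : ∀ {N m} → PipeDream m → Vec (Fin N) m → Crossings N → Vec (Fin N) m
trace []      _  C = []
trace (x ∷ P) ts C =
  let l , ds , C′ = traceRow x ts C
  in  l ∷ trace P ds C′

leftEdge : ∀ {n} → PipeDream n → Vec (Fin n) n
leftEdge {n} P = trace P (allFin n) []

PD : ∀ {n} → Permutation′ n → PipeDream n → Set
PD w P = leftEdge P ≡ tabulate (w ⟨$⟩ʳ_)

PD[_,_] : ∀ {n} → Permutation′ n → Vec ℕ n → PipeDream n → Set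
PD[ w , α ] P = PD w P × wtPD P ≡ α

-- A subset of the n × n grid, given by its rows.
Region : ℕ → Set
Region n = Vec (Subset n) n

∅ : ∀ {n} → Region n
∅ {n} = replicate n ⊥

_∈ᵣ_ : ∀ {n} → Fin n × Fin n → Region n → Set
(i , j) ∈ᵣ S = j ∈ lookup S i

insert remove : ∀ {n} → Fin n × Fin n → Region n → Region n
insert (i , j) S = S [ i ]%= (_∪ ⁅ j ⁆)
remove (i , j) S = S [ i ]%= (_- j)

rothe : ∀ {n} → Permutation′ n → Region n
rothe w = tabulate λ i → tabulate λ j →
  does ((i <? (w ⟨$⟩ˡ j)) ×-dec (j <? (w ⟨$⟩ʳ i)))

record GraveDiagram (n : ℕ) : Set where
  constructor grave
  field
    boxes     : Region n
    ghosts    : Region n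
    .disjoint : ∀ c → c ∈ᵣ boxes → ¬ (c ∈ᵣ ghosts)

open GraveDiagram public

module _ {n : ℕ} where

  wt : GraveDiagram n → Vec ℕ n
  wt E = tabulate λ i → ∣ lookup (boxes E) i ∪ lookup (ghosts E) i ∣

  IsBox IsGhost Occupied : GraveDiagram n → Fin n → Fin n → Set
  IsBox    E i j = (i , j) ∈ᵣ boxes E
  IsGhost  E i j = (i , j) ∈ᵣ ghosts E
  Occupied E i j = IsBox E i j ⊎ IsGhost E i j

  RightmostInRow : GraveDiagram n → Fin n → Fin n → Set
  RightmostInRow E i j = ∀ k → Occupied E i k → k ≤ j

  -- i′ is the largest r < i such that (r , j) is not occupied.
  IsTarget : GraveDiagram n → Fin n → Fin n → Fin n → Set
  IsTarget E i j i′ =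
    (i′ < i × ¬ Occupied E i′ j) × (∀ r → r < i → ¬ Occupied E r j → r ≤ i′)

  record BoxMovable (E : GraveDiagram n) (i j i′ : Fin n) : Set where
    field
      isBox     : IsBox E i j
      rightmost : RightmostInRow E i j
      target    : IsTarget E i j i′
      between   : ∀ r → i′ < r → r ≤ i → Occupied E r j → IsBox E r j

  record GhostMovable (E : GraveDiagram n) (i j i′ : Fin n) : Set where
    field
      isGhost   : IsGhost E i j
      rightmost : RightmostInRow E i j
      target    : IsTarget E i j i′
      between   : ∀ r → i′ < r → r < i → Occupied E r j → IsGhost E r j

  data _⟶_ (E E′ : GraveDiagram n) : Set where

    kohnert : ∀ {i j i′} → BoxMovable E i j i′ →
      boxes  E′ ≡ insert (i′ , j) (remove (i , j) (boxes E)) →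
      ghosts E′ ≡ ghosts E →
      E ⟶ E′

    K-kohnert : ∀ {i j i′} → BoxMovable E i j i′ →
      boxes  E′ ≡ insert (i′ , j) (remove (i , j) (boxes E)) →
      ghosts E′ ≡ insert (i , j) (ghosts E) →
      E ⟶ E′

    ghost : ∀ {i j i′} → GhostMovable E i j i′ →
      boxes  E′ ≡ boxes E →
      ghosts E′ ≡ insert (i′ , j) (remove (i , j) (ghosts E)) →
      E ⟶ E′

    ghost-K : ∀ {i j i′} → GhostMovable E i j i′ →
      boxes  E′ ≡ boxes E →
      ghosts E′ ≡ insert (i′ , j) (ghosts E) →
      E ⟶ E′

∉∅ : ∀ {n} (c : Fin n × Fin n) → ¬ (c ∈ᵣ ∅)
∉∅ {n} (i , j) c∈∅ = ∉⊥ (subst (j ∈_) (lookup-replicate i ⊥) c∈∅)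

initial : ∀ {n} → Permutation′ n → GraveDiagram n
initial w = grave (rothe w) ∅ (λ c _ → ∉∅ c)

GKKoh : ∀ {n} → Permutation′ n → GraveDiagram n → Set
GKKoh w E = Star _⟶_ (initial w) E

GKKoh[_,_] : ∀ {n} → Permutation′ n → Vec ℕ n → GraveDiagram n → Set
GKKoh[ w , α ] E = GKKoh w E × wt E ≡ α

-- 123765948 in one-line notation.
u : Permutation′ 9
u = permutation (lookup to) (lookup from)
      (toWitness {a? = all? λ i → lookup to (lookup from i) ≟ i} _)
      (toWitness {a? = all? λ i → lookup from (lookup to i) ≟ i} _)
  where
  to from : Vec (Fin 9) 9
  to   = 0F ∷ 1F ∷ 2F ∷ 6F ∷ 5F ∷ 4F ∷ 8F ∷ 3F ∷ 7F ∷ []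
  from = 0F ∷ 1F ∷ 2F ∷ 7F ∷ 5F ∷ 4F ∷ 3F ∷ 8F ∷ 6F ∷ []

β : Vec ℕ 9
β = 4 ∷ 4 ∷ 4 ∷ 4 ∷ 1 ∷ 0 ∷ 0 ∷ 0 ∷ 0 ∷ []

{-# OPTIONS --safe #-}

-- A move changes a single column of a grave diagram, and all it needs to know about
-- the other columns is that those further right are vacant in the row of the moved
-- cell.  So any set of columns evolves by itself, up to dropping some of these
-- conditions.  For u only the columns 4, 5, 6, 8 (counted from 1) are ever occupied, and
-- weight β fills them in rows 1 to 4, leaving one more cell in row 5.  Column 8 affects
-- the others through the position of its lowest occupied cell, which never moves down
-- and always blocks its row.  From every unwanted final configuration one can therefore
-- search backwards among small abstract states (columns 4, 5, 6 and that position): the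
-- initial state does not turn up.  Pipe dreams are enumerated row by row, each row being
-- discarded as soon as the wrong pipe leaves it on the left.
module Submission where

open import Defs
open import Data.Bool.Base using (Bool; true; false; _∧_; _∨_; not; if_then_else_)
open import Data.Bool.ListAction using (all)
open import Data.Bool.Properties using (∨-zeroʳ; ¬-not; ∧-conicalˡ; ∧-conicalʳ)
open import Data.Empty using (⊥; ⊥-elim; ⊥-elim-irr)
open import Data.Fin.Base using (Fin; zero; suc; _<_)
open import Data.Fin.Patterns using (0F; 1F; 2F; 3F; 4F; 5F; 6F; 7F; 8F)
open import Data.Fin.Permutation using (_⟨$⟩ʳ_)
open import Data.Fin.Properties using (_≟_; _≤?_; _<?_; all?; <⇒≢)
open import Data.Fin.Subset using (Subset; ⁅_⁆; ∣_∣; ⊤; _∪_; _-_)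
open import Data.Fin.Subset.Properties
  using (∪-identityʳ; p─⊥≡p; ∣p∣≡n⇒p≡⊤) renaming (_∈?_ to _∈ˢ?_)
open import Data.List.Base as List
  using (List; []; _∷_; _++_; filter; filterᵇ; concatMap; cartesianProductWith)
import Data.List.Membership.DecPropositional as DecMembership
open import Data.List.Membership.Propositional using (_∈_)
open import Data.List.Membership.Propositional.Properties
  using (∈-map⁺; ∈-++⁺ˡ; ∈-++⁺ʳ; ∈-filter⁺; ∈-concatMap⁺; ∈-allFin)
open import Data.List.Relation.Unary.Any as Any using (here; there)
open import Data.Maybe.Base using (Maybe; just; nothing; maybe; fromMaybe; from-just)
open import Data.Nat.Base using (ℕ; zero; suc; z<s; s<s)
import Data.Nat.Properties as ℕ
open import Data.Product.Base using (_×_; _,_; proj₁; proj₂; ∃)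
open import Data.Sum.Base using (_⊎_; inj₁; inj₂)
open import Data.Vec.Base as Vec using (Vec; []; _∷_; [_]; lookup; tabulate; count; allFin)
open import Data.Vec.Membership.Propositional using () renaming (_∈_ to _∈ᵥ_)
open import Data.Vec.Membership.Propositional.Properties using (∈-toList⁻)
open import Data.Vec.Properties
  using (≡-dec; ∷-injectiveˡ; ∷-injectiveʳ; []=⇒lookup; lookup⇒[]=; lookup-map; lookup-zipWith;
         lookup∘tabulate; tabulate∘lookup; tabulate-cong; lookup∘updateAt; lookup∘updateAt′)
open import Data.Vec.Relation.Unary.All as All using (All; []; _∷_)
open import Data.Vec.Relation.Unary.AllPairs using (AllPairs; []; _∷_; allPairs?)
import Data.Vec.Relation.Unary.Any as VecAny
open import Function.Base using (_∘_; _∋_; const)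
open import Function.Bundles using (mk⇔)
open import Relation.Binary.Construct.Closure.ReflexiveTransitive using (Star; ε; _◅_)
open import Relation.Binary.Definitions using (DecidableEquality)
open import Relation.Binary.PropositionalEquality
  using (_≡_; _≢_; refl; sym; trans; subst; cong; cong₂)
open import Relation.Nullary using (¬_; Dec; yes; no; does; contradiction)
open import Relation.Nullary.Decidable
  using (map′; _×-dec_; _⊎-dec_; _→-dec_; ¬?; from-yes; dec-true)

-- Pipe dreams

rowsWith : ℕ → ∀ m → List (Vec Tile m)
rowsWith zero    zero    = [] ∷ []
rowsWith (suc k) zero    = []
rowsWith zero    (suc m) = List.map (bump ∷_) (rowsWith zero m)
rowsWith (suc k) (suc m) =
  List.map (cross ∷_) (rowsWith k m) ++ List.map (bump ∷_) (rowsWith (suc k) m)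

∈-rowsWith : ∀ {m} (r : Vec Tile m) → r ∈ rowsWith (count isCross? r) m
∈-rowsWith []          = here refl
∈-rowsWith (cross ∷ r) = ∈-++⁺ˡ (∈-map⁺ (cross ∷_) (∈-rowsWith r))
-- `rowsWith` splits on the number of crosses first, so this number has to be exposed before the
-- list unfolds.
∈-rowsWith (bump ∷ r) with count isCross? r | ∈-rowsWith r
... | zero  | r∈ = ∈-map⁺ (bump ∷_) r∈
... | suc k | r∈ = ∈-++⁺ʳ (List.map (cross ∷_) (rowsWith k _)) (∈-map⁺ (bump ∷_) r∈)

module _ {N : ℕ} where

  pipeDreams : ∀ {m} → Vec (Fin N) m → Vec ℕ m → Vec (Fin N) m → Crossings N →
               List (PipeDream m)
  -- The traced row comes in as an argument, so one trace serves both the comparison with the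
  -- required label and the search in the rows below.
  extensions : ∀ {m} → Fin N → Vec (Fin N) m → Vec ℕ m →
               Fin N × Vec (Fin N) m × Crossings N → Vec Tile m → List (PipeDream (suc m))

  pipeDreams []       []      ts C = [] ∷ []
  pipeDreams (l ∷ ls) (k ∷ α) ts C =
    concatMap (λ r → extensions l ls α (traceRow r ts C) r) (rowsWith k _)

  extensions l ls α (l′ , ds , C) r with l′ ≟ l
  ... | yes _ = List.map (r ∷_) (pipeDreams ls α ds C)
  ... | no  _ = []

  -- With the word and weight of `P` itself as targets, every comparison along `P` succeeds. The
  -- prescribed word and weight are substituted afterwards.
  ∈-pipeDreams : ∀ {m} (P : PipeDream m) ts C →
                 P ∈ pipeDreams (trace P ts C) (wtPD P) ts C
  ∈-pipeDreams []      ts C = here refl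
  ∈-pipeDreams (r ∷ P) ts C =
    ∈-concatMap⁺ _ (Any.map (λ { refl → ∈-extensions (traceRow r ts C) }) (∈-rowsWith r))
    where
    ∈-extensions : (t : Fin N × Vec (Fin N) _ × Crossings N) →
                   let l , ds , C′ = t in
                   (r ∷ P) ∈ extensions l (trace P ds C′) (wtPD P) t r
    ∈-extensions (l , ds , C′) with l ≟ l
    ... | yes _  = ∈-map⁺ (r ∷_) (∈-pipeDreams P ds C′)
    ... | no l≢l = contradiction refl l≢l

dream : Vec Tile 5 → Vec Tile 4 → PipeDream 9
dream r₄ r₅ =
    (bump ∷ bump ∷ bump ∷ cross ∷ cross ∷ cross ∷ bump ∷ cross ∷ [])
  ∷ (bump ∷ bump ∷ cross ∷ cross ∷ cross ∷ bump ∷ cross ∷ [])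
  ∷ (bump ∷ cross ∷ cross ∷ cross ∷ bump ∷ cross ∷ [])
  ∷ r₄
  ∷ r₅
  ∷ (bump ∷ bump ∷ bump ∷ [])
  ∷ (bump ∷ bump ∷ [])
  ∷ (bump ∷ [])
  ∷ []
  ∷ []

dreams : Vec (PipeDream 9) 3
dreams = dream (cross ∷ cross ∷ cross ∷ bump ∷ cross ∷ []) (bump ∷ bump ∷ cross ∷ bump ∷ [])
       ∷ dream (cross ∷ cross ∷ bump ∷ cross ∷ cross ∷ []) (cross ∷ bump ∷ bump ∷ bump ∷ [])
       ∷ dream (cross ∷ cross ∷ bump ∷ cross ∷ cross ∷ []) (bump ∷ bump ∷ cross ∷ bump ∷ [])
       ∷ []

-- The exhaustive search is carried out by evaluation.
pipeDreams-u-β : pipeDreams (tabulate (u ⟨$⟩ʳ_)) β (allFin 9) [] ≡ Vec.toList dreams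
pipeDreams-u-β = refl

card-PD : HasCardinality PD[ u , β ] 3
card-PD = dreams , unique , λ P → mk⇔ sound (complete P)
  where
  unique = ((λ ()) ∷ (λ ()) ∷ []) ∷ ((λ ()) ∷ []) ∷ [] ∷ []

  sound : ∀ {P} → P ∈ᵥ dreams → PD[ u , β ] P
  sound (VecAny.here refl)                             = refl , refl
  sound (VecAny.there (VecAny.here refl))              = refl , refl
  sound (VecAny.there (VecAny.there (VecAny.here refl))) = refl , refl

  complete : ∀ P → PD[ u , β ] P → P ∈ᵥ dreams
  complete P (w-P , wt-P) = ∈-toList⁻
    (subst (P ∈_)
      (trans (cong₂ (λ ls α → pipeDreams ls α (allFin 9) []) w-P wt-P) pipeDreams-u-β)
      (∈-pipeDreams P (allFin 9) []))

-- Moves seen from the columns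

lookup-ext : ∀ {A : Set} {n} {xs ys : Vec A n} → (∀ i → lookup xs i ≡ lookup ys i) → xs ≡ ys
lookup-ext {xs = xs} {ys} eq =
  trans (sym (tabulate∘lookup xs)) (trans (tabulate-cong eq) (tabulate∘lookup ys))

bit : ∀ {n} → Region n → Fin n → Fin n → Bool
bit S i j = lookup (lookup S i) j

lookup-∪⁅⁆ : ∀ {n} (p : Subset n) j → lookup (p ∪ ⁅ j ⁆) j ≡ true
lookup-∪⁅⁆ (x ∷ p) zero    = ∨-zeroʳ x
lookup-∪⁅⁆ (x ∷ p) (suc j) = lookup-∪⁅⁆ p j

lookup-∪⁅⁆-other : ∀ {n} (p : Subset n) j {k} → k ≢ j → lookup (p ∪ ⁅ j ⁆) k ≡ lookup p k
lookup-∪⁅⁆-other (x ∷ p) zero    {zero}  k≢j = contradiction refl k≢j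
lookup-∪⁅⁆-other (x ∷ p) zero    {suc k} k≢j = cong (λ q → lookup q k) (∪-identityʳ p)
lookup-∪⁅⁆-other (false ∷ p) (suc j) {zero}  k≢j = refl
lookup-∪⁅⁆-other (true ∷ p) (suc j) {zero}  k≢j = refl
lookup-∪⁅⁆-other (x ∷ p) (suc j) {suc k} k≢j = lookup-∪⁅⁆-other p j (k≢j ∘ cong suc)

lookup-remove : ∀ {n} (p : Subset n) j → lookup (p - j) j ≡ false
lookup-remove (x ∷ p) zero    = refl
lookup-remove (x ∷ p) (suc j) = lookup-remove p j

lookup-remove-other : ∀ {n} (p : Subset n) j {k} → k ≢ j → lookup (p - j) k ≡ lookup p k
lookup-remove-other (x ∷ p) zero    {zero}  k≢j = contradiction refl k≢j
lookup-remove-other (x ∷ p) zero    {suc k} k≢j = cong (λ q → lookup q k) (p─⊥≡p p)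
lookup-remove-other (x ∷ p) (suc j) {zero}  k≢j = refl
lookup-remove-other (x ∷ p) (suc j) {suc k} k≢j = lookup-remove-other p j (k≢j ∘ cong suc)

module _ {n : ℕ} (S : Region n) (i j : Fin n) where

  bit-insert : bit (insert (i , j) S) i j ≡ true
  bit-insert = trans (cong (λ p → lookup p j) (lookup∘updateAt i S)) (lookup-∪⁅⁆ (lookup S i) j)

  bit-insert-column : ∀ {r k} → k ≢ j → bit (insert (i , j) S) r k ≡ bit S r k
  bit-insert-column {r} {k} k≢j with r ≟ i
  ... | yes refl = trans (cong (λ p → lookup p k) (lookup∘updateAt i S))
                         (lookup-∪⁅⁆-other (lookup S i) j k≢j)
  ... | no r≢i   = cong (λ p → lookup p k) (lookup∘updateAt′ r i r≢i S)

  bit-insert-row : ∀ {r k} → r ≢ i → bit (insert (i , j) S) r k ≡ bit S r k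
  bit-insert-row {r} {k} r≢i = cong (λ p → lookup p k) (lookup∘updateAt′ r i r≢i S)

  bit-remove : bit (remove (i , j) S) i j ≡ false
  bit-remove = trans (cong (λ p → lookup p j) (lookup∘updateAt i S)) (lookup-remove (lookup S i) j)

  bit-remove-column : ∀ {r k} → k ≢ j → bit (remove (i , j) S) r k ≡ bit S r k
  bit-remove-column {r} {k} k≢j with r ≟ i
  ... | yes refl = trans (cong (λ p → lookup p k) (lookup∘updateAt i S))
                         (lookup-remove-other (lookup S i) j k≢j)
  ... | no r≢i   = cong (λ p → lookup p k) (lookup∘updateAt′ r i r≢i S)

  bit-remove-row : ∀ {r k} → r ≢ i → bit (remove (i , j) S) r k ≡ bit S r k
  bit-remove-row {r} {k} r≢i = cong (λ p → lookup p k) (lookup∘updateAt′ r i r≢i S)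

module _ {n : ℕ} (S : Region n) (i i′ j : Fin n) (i′≢i : i′ ≢ i) where

  private S′ = insert (i′ , j) (remove (i , j) S)

  bit-shift-source : bit S′ i j ≡ false
  bit-shift-source = trans (bit-insert-row (remove (i , j) S) i′ j (i′≢i ∘ sym)) (bit-remove S i j)

  bit-shift-row : ∀ {r k} → r ≢ i′ → r ≢ i → bit S′ r k ≡ bit S r k
  bit-shift-row r≢i′ r≢i =
    trans (bit-insert-row (remove (i , j) S) i′ j r≢i′) (bit-remove-row S i j r≢i)

  bit-shift-column : ∀ {r k} → k ≢ j → bit S′ r k ≡ bit S r k
  bit-shift-column k≢j =
    trans (bit-insert-column (remove (i , j) S) i′ j k≢j) (bit-remove-column S i j k≢j)

data Cell : Set where
  vacant box ghost : Cell

Column : ℕ → Set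
Column n = Vec Cell n

data Piece : Cell → Set where
  box   : Piece box
  ghost : Piece ghost

data Trail : Cell → Set where
  vacant : Trail vacant
  ghost  : Trail ghost

-- All four kinds of moves look alike: a piece p climbs over pieces of its own kind into
-- a vacant cell, leaving nothing or a ghost behind.  Lift p i is what happens below that
-- cell.
data Lift (p : Cell) : ∀ {n} → Fin n → Column n → Column n → Set where
  leave : ∀ {n q} {c : Column n} → Trail q → Lift p zero (p ∷ c) (q ∷ c)
  pass  : ∀ {n i} {c c′ : Column n} → Lift p i c c′ → Lift p (suc i) (p ∷ c) (p ∷ c′)

-- The index is the source row, the only row in which the columns further right matter.
data ColumnMove : ∀ {n} → Fin n → Column n → Column n → Set where
  land : ∀ {n i p} {c c′ : Column n} → Piece p → Lift p i c c′ →
         ColumnMove (suc i) (vacant ∷ c) (p ∷ c′)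
  skip : ∀ {n i x} {c c′ : Column n} → ColumnMove i c c′ →
         ColumnMove (suc i) (x ∷ c) (x ∷ c′)

lift⁺ : ∀ {n p q i} {c c′ : Column n} → Trail q →
        lookup c i ≡ p → (∀ r → r < i → lookup c r ≡ p) →
        lookup c′ i ≡ q → (∀ r → r ≢ i → lookup c′ r ≡ lookup c r) → Lift p i c c′
lift⁺ {i = zero} {_ ∷ c} {_ ∷ c′} tq refl _ refl same
  rewrite lookup-ext {xs = c′} {c} (λ r → same (suc r) λ ()) = leave tq
lift⁺ {i = suc i} {_ ∷ _} {_ ∷ _} tq c-i below c′-i same
  rewrite same zero (λ ()) | below zero z<s =
  pass (lift⁺ tq c-i (λ r r<i → below (suc r) (s<s r<i)) c′-i
         (λ r r≢i → same (suc r) λ { refl → r≢i refl }))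

-- The entries fix both columns completely, so peeling off rows from the top down to the target row
-- builds the derivation.
columnMove⁺ : ∀ {n p q i i′} {c c′ : Column n} → Piece p → Trail q → i′ < i →
  lookup c i′ ≡ vacant → lookup c i ≡ p → (∀ r → i′ < r → r < i → lookup c r ≡ p) →
  lookup c′ i′ ≡ p → lookup c′ i ≡ q →
  (∀ r → r ≢ i′ → r ≢ i → lookup c′ r ≡ lookup c r) → ColumnMove i c c′
columnMove⁺ {i = suc i} {zero} {_ ∷ c} {_ ∷ c′} pp tq _ refl c-i below refl c′-i same =
  land pp (lift⁺ tq c-i (λ r r<i → below (suc r) z<s (s<s r<i)) c′-i
            (λ r r≢i → same (suc r) (λ ()) λ { refl → r≢i refl }))
columnMove⁺ {i = suc i} {suc i′} {_ ∷ c} {_ ∷ c′} pp tq (s<s i′<i) c-i′ c-i below c′-i′ c′-i same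
  rewrite same zero (λ ()) (λ ()) =
  skip (columnMove⁺ pp tq i′<i c-i′ c-i (λ r i′<r r<i → below (suc r) (s<s i′<r) (s<s r<i))
         c′-i′ c′-i (λ r r≢i′ r≢i → same (suc r) (λ { refl → r≢i′ refl }) (λ { refl → r≢i refl })))

-- The value at two true bits is a convention: boxes and ghosts are disjoint.
cell : Bool → Bool → Cell
cell true  _     = box
cell false true  = ghost
cell false false = vacant

module _ {n : ℕ} where

  cellAt : GraveDiagram n → Fin n → Fin n → Cell
  cellAt E i j = cell (bit (boxes E) i j) (bit (ghosts E) i j)

  column : GraveDiagram n → Fin n → Column n
  column E j = tabulate λ i → cellAt E i j

  disjoint-bits : ∀ (E : GraveDiagram n) i j →
                  bit (boxes E) i j ≡ true → bit (ghosts E) i j ≡ true → ⊥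
  disjoint-bits (grave _ _ d) i j b g =
    -- The disjointness field is irrelevant, so it can only be consumed by an irrelevant
    -- elimination.
    ⊥-elim-irr (d (i , j) (lookup⇒[]= j _ b) (lookup⇒[]= j _ g))

  module _ (E : GraveDiagram n) {i j : Fin n} where

    ghost⇒¬box : IsGhost E i j → bit (boxes E) i j ≡ false
    ghost⇒¬box g = ¬-not λ b → disjoint-bits E i j b ([]=⇒lookup g)

    box⇒¬ghost : IsBox E i j → bit (ghosts E) i j ≡ false
    box⇒¬ghost b = ¬-not (disjoint-bits E i j ([]=⇒lookup b))

    cellAt-box : IsBox E i j → cellAt E i j ≡ box
    cellAt-box b rewrite []=⇒lookup b = refl

    cellAt-ghost : IsGhost E i j → cellAt E i j ≡ ghost
    cellAt-ghost g rewrite ghost⇒¬box g | []=⇒lookup g = refl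

    occupied : cellAt E i j ≢ vacant → Occupied E i j
    occupied ¬v with bit (boxes E) i j in b | bit (ghosts E) i j in g
    ... | true  | _     = inj₁ (lookup⇒[]= j _ b)
    ... | false | true  = inj₂ (lookup⇒[]= j _ g)
    ... | false | false = contradiction refl ¬v

    vacant⇒bits : ¬ Occupied E i j →
                  bit (boxes E) i j ≡ false × bit (ghosts E) i j ≡ false
    vacant⇒bits ¬o = ¬-not (¬o ∘ inj₁ ∘ lookup⇒[]= j _) , ¬-not (¬o ∘ inj₂ ∘ lookup⇒[]= j _)

    cellAt-vacant : ¬ Occupied E i j → cellAt E i j ≡ vacant
    cellAt-vacant ¬o with b , g ← vacant⇒bits ¬o rewrite b | g = refl

  -- The common shape of the four moves in terms of cells: `p` is the kind of the moving piece and
  -- `q` what stays behind at the source.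
  record Shift (E E′ : GraveDiagram n) (i j i′ : Fin n) (p q : Cell) : Set where
    field
      piece   : Piece p
      trail   : Trail q
      at-i    : cellAt E i j ≡ p
      between : ∀ r → i′ < r → r < i → Occupied E r j → cellAt E r j ≡ p
      to-i′   : cellAt E′ i′ j ≡ p
      to-i    : cellAt E′ i j ≡ q
      rows    : ∀ {r k} → r ≢ i′ → r ≢ i → cellAt E′ r k ≡ cellAt E r k
      columns : ∀ {r k} → k ≢ j → cellAt E′ r k ≡ cellAt E r k

  record Step (E E′ : GraveDiagram n) : Set where
    field
      row col  : Fin n
      clear    : ∀ k → col < k → lookup (column E k) row ≡ vacant
      moved    : ColumnMove row (column E col) (column E′ col)
      unmoved  : ∀ k → k ≢ col → column E′ k ≡ column E k

  shift⇒step : ∀ {E E′ : GraveDiagram n} {i j i′ p q} → RightmostInRow E i j → IsTarget E i j i′ →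
               Shift E E′ i j i′ p q → Step E E′
  shift⇒step {E} {E′} {i} {j} {i′} rightmost ((i′<i , ¬occ) , largest) sh = record
    { row = i ; col = j
    ; clear   = λ k j<k → trans (lookup∘tabulate _ i)
                  (cellAt-vacant E λ occ → ℕ.<⇒≱ j<k (rightmost k occ))
    ; moved   = columnMove⁺ piece trail i′<i
                  (at E i′ (cellAt-vacant E ¬occ)) (at E i at-i)
                  (λ r i′<r r<i → at E r (between r i′<r r<i (occ r i′<r r<i)))
                  (at E′ i′ to-i′) (at E′ i to-i)
                  (λ r r≢i′ r≢i → at E′ r (trans (rows r≢i′ r≢i) (sym (lookup∘tabulate _ r))))
    ; unmoved = λ k k≢j → tabulate-cong λ r → columns k≢j
    }
    where
    open Shift sh
    at : ∀ F r {x} → cellAt F r j ≡ x → lookup (column F j) r ≡ x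
    at F r = trans (lookup∘tabulate (λ r → cellAt F r j) r)

    -- A vacant cell strictly between would be a target further down than `i′`, against maximality.
    occ : ∀ r → i′ < r → r < i → Occupied E r j
    occ r i′<r r<i = occupied E λ v → ℕ.<⇒≱ i′<r (largest r r<i (¬occ′ v))
      where
      ¬occ′ : cellAt E r j ≡ vacant → ¬ Occupied E r j
      ¬occ′ v (inj₁ b) with () ← trans (sym v) (cellAt-box E b)
      ¬occ′ v (inj₂ g) with () ← trans (sym v) (cellAt-ghost E g)

  step : ∀ {E E′ : GraveDiagram n} → E ⟶ E′ → Step E E′
  step {E} {E′} (kohnert {i} {j} {i′} m refl refl) = shift⇒step rightmost target record
    { piece = box ; trail = vacant
    ; at-i = cellAt-box E isBox
    ; between = λ r i′<r r<i occ → cellAt-box E (between r i′<r (ℕ.<⇒≤ r<i) occ)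
    ; to-i′ = cong₂ cell (bit-insert (remove (i , j) (boxes E)) i′ j) refl
    -- By disjointness no ghost comes to light where the box stood.
    ; to-i = cong₂ cell (bit-shift-source (boxes E) i i′ j i′≢i) (box⇒¬ghost E isBox)
    ; rows = λ r≢i′ r≢i → cong₂ cell (bit-shift-row (boxes E) i i′ j i′≢i r≢i′ r≢i) refl
    ; columns = λ k≢j → cong₂ cell (bit-shift-column (boxes E) i i′ j i′≢i k≢j) refl
    }
    where
    open BoxMovable m
    i′≢i = <⇒≢ (proj₁ (proj₁ target))
  step {E} {E′} (K-kohnert {i} {j} {i′} m refl refl) = shift⇒step rightmost target record
    { piece = box ; trail = ghost
    ; at-i = cellAt-box E isBox
    ; between = λ r i′<r r<i occ → cellAt-box E (between r i′<r (ℕ.<⇒≤ r<i) occ)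
    ; to-i′ = cong₂ cell (bit-insert (remove (i , j) (boxes E)) i′ j) refl
    ; to-i = cong₂ cell (bit-shift-source (boxes E) i i′ j i′≢i) (bit-insert (ghosts E) i j)
    ; rows = λ r≢i′ r≢i → cong₂ cell (bit-shift-row (boxes E) i i′ j i′≢i r≢i′ r≢i)
                                   (bit-insert-row (ghosts E) i j r≢i)
    ; columns = λ k≢j → cong₂ cell (bit-shift-column (boxes E) i i′ j i′≢i k≢j)
                                 (bit-insert-column (ghosts E) i j k≢j)
    }
    where
    open BoxMovable m
    i′≢i = <⇒≢ (proj₁ (proj₁ target))
  step {E} {E′} (ghost {i} {j} {i′} m refl refl) = shift⇒step rightmost target record
    { piece = ghost ; trail = vacant
    ; at-i = cellAt-ghost E isGhost
    ; between = λ r i′<r r<i occ → cellAt-ghost E (between r i′<r r<i occ)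
    -- The target was vacant, so no box hides the ghost that arrives there.
    ; to-i′ = cong₂ cell (proj₁ (vacant⇒bits E (proj₂ (proj₁ target))))
                        (bit-insert (remove (i , j) (ghosts E)) i′ j)
    ; to-i = cong₂ cell (ghost⇒¬box E isGhost) (bit-shift-source (ghosts E) i i′ j i′≢i)
    ; rows = λ r≢i′ r≢i → cong₂ cell refl (bit-shift-row (ghosts E) i i′ j i′≢i r≢i′ r≢i)
    ; columns = λ k≢j → cong₂ cell refl (bit-shift-column (ghosts E) i i′ j i′≢i k≢j)
    }
    where
    open GhostMovable m
    i′≢i = <⇒≢ (proj₁ (proj₁ target))
  step {E} {E′} (ghost-K {i} {j} {i′} m refl refl) = shift⇒step rightmost target record
    { piece = ghost ; trail = ghost
    ; at-i = cellAt-ghost E isGhost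
    ; between = λ r i′<r r<i occ → cellAt-ghost E (between r i′<r r<i occ)
    ; to-i′ = cong₂ cell (proj₁ (vacant⇒bits E (proj₂ (proj₁ target)))) (bit-insert (ghosts E) i′ j)
    ; to-i = trans (cong (cell _) (bit-insert-row (ghosts E) i′ j (i′≢i ∘ sym)))
                   (cellAt-ghost E isGhost)
    ; rows = λ r≢i′ r≢i → cong₂ cell refl (bit-insert-row (ghosts E) i′ j r≢i′)
    ; columns = λ k≢j → cong₂ cell refl (bit-insert-column (ghosts E) i′ j k≢j)
    }
    where
    open GhostMovable m
    i′≢i = <⇒≢ (proj₁ (proj₁ target))

  -- Disjointness makes `cell` injective on the pairs of bits that occur, and the proofs of
  -- disjointness, being irrelevant, do not tell diagrams apart.
  column-injective : ∀ {E E′ : GraveDiagram n} → (∀ j → column E j ≡ column E′ j) → E ≡ E′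
  column-injective {E} {E′} eq = grave-cong boxes≡ ghosts≡
    where
    cells : ∀ i j → cellAt E i j ≡ cellAt E′ i j
    cells i j = trans (sym (lookup∘tabulate _ i))
                  (trans (cong (λ c → lookup c i) (eq j)) (lookup∘tabulate _ i))

    cell-injective : ∀ {b g b′ g′} → (b ≡ true → g ≡ true → ⊥) → (b′ ≡ true → g′ ≡ true → ⊥) →
                     cell b g ≡ cell b′ g′ → b ≡ b′ × g ≡ g′
    cell-injective {true}  {true}  d _ _ = ⊥-elim (d refl refl)
    cell-injective {true}  {false} {true}  {true}  _ d _ = ⊥-elim (d refl refl)
    cell-injective {true}  {false} {true}  {false} _ _ _ = refl , refl
    cell-injective {true}  {false} {false} {true}  _ _ ()
    cell-injective {true}  {false} {false} {false} _ _ ()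
    cell-injective {false} {true}  {false} {true}  _ _ _ = refl , refl
    cell-injective {false} {false} {true}  {_}     _ _ ()
    cell-injective {false} {false} {false} {false} _ _ _ = refl , refl

    bits : ∀ i j → bit (boxes E) i j ≡ bit (boxes E′) i j × bit (ghosts E) i j ≡ bit (ghosts E′) i j
    bits i j = cell-injective
      (disjoint-bits E i j) (disjoint-bits E′ i j) (cells i j)

    boxes≡ : boxes E ≡ boxes E′
    boxes≡ = lookup-ext λ i → lookup-ext λ j → proj₁ (bits i j)

    ghosts≡ : ghosts E ≡ ghosts E′
    ghosts≡ = lookup-ext λ i → lookup-ext λ j → proj₂ (bits i j)

    grave-cong : ∀ {E E′ : GraveDiagram n} → boxes E ≡ boxes E′ → ghosts E ≡ ghosts E′ → E ≡ E′
    grave-cong refl refl = refl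

-- Moves within a column, forwards and backwards

_≟ᶜ_ : DecidableEquality Cell
vacant ≟ᶜ vacant = yes refl
vacant ≟ᶜ box    = no λ ()
vacant ≟ᶜ ghost  = no λ ()
box    ≟ᶜ vacant = no λ ()
box    ≟ᶜ box    = yes refl
box    ≟ᶜ ghost  = no λ ()
ghost  ≟ᶜ vacant = no λ ()
ghost  ≟ᶜ box    = no λ ()
ghost  ≟ᶜ ghost  = yes refl

_≟ᵛ_ : ∀ {n} → DecidableEquality (Column n)
_≟ᵛ_ = ≡-dec _≟ᶜ_

lifts : ∀ {n} → Cell → Column n → List (Column n)
lifts box   (box   ∷ c) = (vacant ∷ c) ∷ (ghost ∷ c) ∷ List.map (box ∷_) (lifts box c)
lifts ghost (ghost ∷ c) = (vacant ∷ c) ∷ (ghost ∷ c) ∷ List.map (ghost ∷_) (lifts ghost c)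
lifts _     _           = []

landings : ∀ {n} → Cell → Column n → List (Column (suc n))
landings vacant c = List.map (box ∷_) (lifts box c) ++ List.map (ghost ∷_) (lifts ghost c)
landings _      c = []

moves : ∀ {n} → Column n → List (Column n)
moves []      = []
moves (x ∷ c) = landings x c ++ List.map (x ∷_) (moves c)

∈-lifts : ∀ {n p i} {c c′ : Column n} → Piece p → Lift p i c c′ → c′ ∈ lifts p c
∈-lifts box   (leave vacant) = here refl
∈-lifts box   (leave ghost)  = there (here refl)
∈-lifts ghost (leave vacant) = here refl
∈-lifts ghost (leave ghost)  = there (here refl)
∈-lifts box   (pass l)       = there (there (∈-map⁺ (box ∷_) (∈-lifts box l)))
∈-lifts ghost (pass l)       = there (there (∈-map⁺ (ghost ∷_) (∈-lifts ghost l)))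

∈-moves : ∀ {n i} {c c′ : Column n} → ColumnMove i c c′ → c′ ∈ moves c
∈-moves (land box l)   = ∈-++⁺ˡ (∈-++⁺ˡ (∈-map⁺ (box ∷_) (∈-lifts box l)))
∈-moves (land {c = c} ghost l) =
  ∈-++⁺ˡ (∈-++⁺ʳ (List.map (box ∷_) (lifts box c)) (∈-map⁺ (ghost ∷_) (∈-lifts ghost l)))
∈-moves (skip {x = x} {c} m) = ∈-++⁺ʳ (landings x c) (∈-map⁺ (x ∷_) (∈-moves m))

under : ∀ {n} → Cell → Fin n × Column n → Fin (suc n) × Column (suc n)
under x (i , c) = suc i , x ∷ c

unlifts : ∀ {n} → Cell → Column n → List (Fin n × Column n)
unlifts p     (vacant ∷ c) = (zero , p ∷ c) ∷ []
unlifts box   (box    ∷ c) = List.map (under box) (unlifts box c)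
unlifts box   (ghost  ∷ c) = (zero , box ∷ c) ∷ []
-- A ghost below the landing cell is ambiguous: it may be the trail left at the source or a piece
-- that was climbed over.
unlifts ghost (ghost  ∷ c) = (zero , ghost ∷ c) ∷ List.map (under ghost) (unlifts ghost c)
unlifts _     _            = []

unlandings : ∀ {n} → Cell → Column n → List (Fin (suc n) × Column (suc n))
unlandings vacant c = []
unlandings x      c = List.map (under vacant) (unlifts x c)

-- Each predecessor comes with its source row, where the columns further right still have to be
-- tested for vacancy.
unmoves : ∀ {n} → Column n → List (Fin n × Column n)
unmoves []      = []
unmoves (x ∷ c) = unlandings x c ++ List.map (under x) (unmoves c)

∈-unlifts : ∀ {n p i} {c c′ : Column n} → Piece p → Lift p i c c′ → (i , c) ∈ unlifts p c′
∈-unlifts box   (leave vacant) = here refl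
∈-unlifts box   (leave ghost)  = here refl
∈-unlifts ghost (leave vacant) = here refl
∈-unlifts ghost (leave ghost)  = here refl
∈-unlifts box   (pass l)       = ∈-map⁺ (under box) (∈-unlifts box l)
∈-unlifts ghost (pass l)       = there (∈-map⁺ (under ghost) (∈-unlifts ghost l))

∈-unmoves : ∀ {n i} {c c′ : Column n} → ColumnMove i c c′ → (i , c) ∈ unmoves c′
∈-unmoves (land box l)   = ∈-++⁺ˡ (∈-map⁺ (under vacant) (∈-unlifts box l))
∈-unmoves (land ghost l) = ∈-++⁺ˡ (∈-map⁺ (under vacant) (∈-unlifts ghost l))
∈-unmoves (skip {x = x} {c′ = c′} m) =
  ∈-++⁺ʳ (unlandings x c′) (∈-map⁺ (under x) (∈-unmoves m))

-- Finite sets of states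

-- A ternary trie keyed by columns, branching on the cells from the top down; a search takes at most
-- one step per row, whatever the size of the set.
data Trie (A : Set) : ℕ → Set where
  none : ∀ {n} → Trie A n
  leaf : A → Trie A zero
  node : ∀ {n} → (v b g : Trie A n) → Trie A (suc n)

module _ {A : Set} where

  find : ∀ {n} → Column n → Trie A n → Maybe A
  find c            none         = nothing
  find []           (leaf a)     = just a
  find (vacant ∷ c) (node v b g) = find c v
  find (box ∷ c)    (node v b g) = find c b
  find (ghost ∷ c)  (node v b g) = find c g

  update : ∀ {n} → Column n → (Maybe A → A) → Trie A n → Trie A n
  update []           f none         = leaf (f nothing)
  update (vacant ∷ c) f none         = node (update c f none) none none
  update (box ∷ c)    f none         = node none (update c f none) none
  update (ghost ∷ c)  f none         = node none none (update c f none)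
  update []           f (leaf a)     = leaf (f (just a))
  update (vacant ∷ c) f (node v b g) = node (update c f v) b g
  update (box ∷ c)    f (node v b g) = node v (update c f b) g
  update (ghost ∷ c)  f (node v b g) = node v b (update c f g)

  allTrie : ∀ {n} → (Column n → A → Bool) → Trie A n → Bool
  allTrie f none         = true
  allTrie f (leaf a)     = f [] a
  allTrie f (node v b g) =
    allTrie (f ∘ (vacant ∷_)) v ∧ allTrie (f ∘ (box ∷_)) b ∧ allTrie (f ∘ (ghost ∷_)) g

  allTrie-find : ∀ {n} f c (t : Trie A n) {a} →
                 allTrie f t ≡ true → find c t ≡ just a → f c a ≡ true
  allTrie-find f []           (leaf a)     p refl = p
  allTrie-find f (vacant ∷ c) (node v b g) p q = allTrie-find _ c v (∧-conicalˡ _ _ p) q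
  allTrie-find f (box ∷ c)    (node v b g) p q =
    allTrie-find _ c b (∧-conicalˡ _ _ (∧-conicalʳ (allTrie (f ∘ (vacant ∷_)) v) _ p)) q
  allTrie-find f (ghost ∷ c)  (node v b g) p q =
    allTrie-find _ c g (∧-conicalʳ (allTrie (f ∘ (box ∷_)) b) _
      (∧-conicalʳ (allTrie (f ∘ (vacant ∷_)) v) _ p)) q

infixr 4 _⇒_

_⇒_ : Bool → Bool → Bool
true  ⇒ b = b
false ⇒ b = true

⇒-elim : ∀ {a b} → (a ⇒ b) ≡ true → a ≡ true → b ≡ true
⇒-elim p refl = p

all-∈ : ∀ {A : Set} f {x : A} {xs} → all f xs ≡ true → x ∈ xs → f x ≡ true
all-∈ f p (here refl) = ∧-conicalˡ _ _ p
all-∈ f p (there x∈)  = all-∈ f (∧-conicalʳ (f _) _ p) x∈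

State : ℕ → Set
State m = Vec (Column 9) m

-- Nested tries, one level per column. A set of states without columns is a single Boolean.
StateSet : ℕ → Set
StateSet zero    = Bool
StateSet (suc m) = Trie (StateSet m) 9

empty : ∀ {m} → StateSet m
empty {zero}  = false
empty {suc m} = none

member : ∀ {m} → State m → StateSet m → Bool
member []       S = S
member (c ∷ cs) S = maybe (member cs) false (find c S)

adjoin : ∀ {m} → State m → StateSet m → StateSet m
adjoin []       S = true
adjoin (c ∷ cs) S = update c (adjoin cs ∘ fromMaybe empty) S

every : ∀ {m} → (State m → Bool) → StateSet m → Bool
every {zero}  f S = S ⇒ f []
every {suc m} f S = allTrie (λ c → every (f ∘ (c ∷_))) S

every-member : ∀ {m} f (cs : State m) S → every f S ≡ true → member cs S ≡ true → f cs ≡ true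
every-member f []       S p q = ⇒-elim p q
every-member f (c ∷ cs) S p q with find c S in eq
... | just S′ = every-member (f ∘ (c ∷_)) cs S′ (allTrie-find _ c S p eq) q

module _ {m : ℕ} (next : State m → List (State m)) (keep : State m → Bool) where

  closure : ℕ → List (State m) → StateSet m → StateSet m
  closure zero    _        S = S
  closure (suc k) []       S = S
  closure (suc k) (s ∷ ss) S =
    if not (member s S) ∧ keep s
    then closure k (next s ++ ss) (adjoin s S)
    else closure k ss S

  -- Tests a set after the fact, however it was obtained; successors rejected by `keep` may lie
  -- outside it.
  closed : StateSet m → Bool
  closed S = every (λ s → all (λ s′ → keep s′ ⇒ member s′ S) (next s)) S

  closed-next : ∀ {s s′} S → closed S ≡ true → member s S ≡ true →
                s′ ∈ next s → keep s′ ≡ true → member s′ S ≡ true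
  closed-next {s} {s′} S p s∈ s′∈ k =
    ⇒-elim (all-∈ (λ s′ → keep s′ ⇒ member s′ S) (every-member _ s S p s∈) s′∈) k

-- Systems of columns

blank : ∀ {n} → Column n
blank = Vec.replicate _ vacant

-- Keeps only the lowest occupied cell, whatever it holds, as a box.
lowest : ∀ {n} → Column n → Column n
lowest []      = []
lowest (x ∷ c) with does (c ≟ᵛ blank) | x
... | false | _      = vacant ∷ lowest c
... | true  | vacant = vacant ∷ c
... | true  | _      = box ∷ c

markers : ∀ n → List (Column n)
markers zero    = []
markers (suc n) = (box ∷ blank) ∷ List.map (vacant ∷_) (markers n)

-- The present position is included, since a move of another piece or one that leaves a ghost behind
-- does not change the lowest occupied row.
lowerings : ∀ {n} → Column n → List (Column n)
lowerings []           = []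
lowerings (vacant ∷ c) = List.map (vacant ∷_) (lowerings c)
lowerings (_ ∷ c)      = markers _

-- Passing to the marker can only relax the vacancy conditions, so no real move is lost.
lookup-lowest : ∀ {n} (c : Column n) {i} → lookup c i ≡ vacant → lookup (lowest c) i ≡ vacant
lookup-lowest (x ∷ c) eq with does (c ≟ᵛ blank) | x
lookup-lowest (x ∷ c) {zero}  eq | false | _ = refl
lookup-lowest (x ∷ c) {suc i} eq | false | _ = lookup-lowest c eq
lookup-lowest (x ∷ c) eq | true | vacant = eq
lookup-lowest (x ∷ c) {suc i} eq | true | box   = eq
lookup-lowest (x ∷ c) {suc i} eq | true | ghost = eq

clear? : ∀ {m} (cs : State m) i → Dec (All (λ c → lookup c i ≡ vacant) cs)
clear? cs i = All.all? (λ c → lookup c i ≟ᶜ vacant) cs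

-- The last column of a state stands for column 8 of the grid and holds a single marker.
undo : ∀ m → State (suc m) → List (State (suc m))
undo zero    (d ∷ [])  = List.map [_] (lowerings d)
undo (suc m) (c ∷ cs) =
  List.map (λ ic → proj₂ ic ∷ cs) (filter (λ ic → clear? cs (proj₁ ic)) (unmoves c))
  ++ List.map (c ∷_) (undo m cs)

undo-here : ∀ {m i c c′} {cs cs′ : State (suc m)} → ColumnMove i c c′ →
            All (λ d → lookup d i ≡ vacant) cs → cs′ ≡ cs → (c ∷ cs) ∈ undo (suc m) (c′ ∷ cs′)
undo-here {cs = cs} cm cl refl = ∈-++⁺ˡ (∈-map⁺ (λ ic → proj₂ ic ∷ cs)
  (∈-filter⁺ (λ ic → clear? cs (proj₁ ic)) (∈-unmoves cm) cl))

undo-there : ∀ {m c c′} {cs cs′ : State (suc m)} → c′ ≡ c →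
             cs ∈ undo m cs′ → (c ∷ cs) ∈ undo (suc m) (c′ ∷ cs′)
undo-there {c = c} {cs′ = cs′} refl cs∈ =
  ∈-++⁺ʳ (List.map (λ ic → proj₂ ic ∷ cs′) (filter (λ ic → clear? cs′ (proj₁ ic)) (unmoves c)))
    (∈-map⁺ (c ∷_) cs∈)

-- A column is moved here without regard to the columns on its right, which overestimates what it
-- can reach.
advance : State 1 → List (State 1)
advance (c ∷ []) = List.map [_] (moves c)

columns : ∀ {m} → Vec (Fin 9) m → GraveDiagram 9 → State (suc m)
columns []       E = lowest (column E 7F) ∷ []
columns (j ∷ js) E = column E j ∷ columns js E

columns-cong : ∀ {m} (js : Vec (Fin 9) m) {E E′} → All (λ j → column E′ j ≡ column E j) js →
               column E′ 7F ≡ column E 7F → columns js E′ ≡ columns js E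
columns-cong []       []         eq = cong (λ c → lowest c ∷ []) eq
columns-cong (j ∷ js) (eqⱼ ∷ eqs) eq = cong₂ _∷_ eqⱼ (columns-cong js eqs eq)

columns-clear : ∀ {m} (js : Vec (Fin 9) m) {E i} → All (λ j → lookup (column E j) i ≡ vacant) js →
                lookup (column E 7F) i ≡ vacant → All (λ c → lookup c i ≡ vacant) (columns js E)
columns-clear []       {E} []       v = lookup-lowest (column E 7F) v ∷ []
columns-clear (j ∷ js) (vⱼ ∷ vs) v = vⱼ ∷ columns-clear js vs v

-- A move in a column outside the state does not change it. Otherwise, as the columns are listed in
-- ascending order before column 8, all later entries of the state lie further right and are vacant
-- in the source row. The last hypothesis says how the marker behaves when column 8 itself moves.
columns-step : ∀ {m} {js : Vec (Fin 9) m} → AllPairs _<_ js → All (_< (Fin 9 ∋ 7F)) js →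
  ∀ {E E′} → Step E E′ →
  (∀ {i} → ColumnMove i (column E 7F) (column E′ 7F) →
    lowest (column E 7F) ∈ lowerings (lowest (column E′ 7F))) →
  columns js E ≡ columns js E′ ⊎ columns js E ∈ undo m (columns js E′)
columns-step [] [] {E} {E′} s low with 7F ≟ Step.col s
... | yes refl = inj₂ (∈-map⁺ [_] (low (Step.moved s)))
... | no 7≢    = inj₁ (cong (λ c → lowest c ∷ []) (sym (Step.unmoved s 7F 7≢)))
columns-step {suc m} {j ∷ js} (j<js ∷ asc) (j<7 ∷ js<7) {E} {E′} s low with j ≟ Step.col s
... | yes refl = inj₂ (undo-here (Step.moved s)
  (columns-clear js {E} (All.map (λ {k} → Step.clear s k) j<js) (Step.clear s 7F j<7))
  (columns-cong js {E} {E′}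
    (All.map (λ {k} j<k → Step.unmoved s k (<⇒≢ j<k ∘ sym)) j<js)
    (Step.unmoved s 7F (<⇒≢ j<7 ∘ sym))))
... | no j≢ with columns-step asc js<7 {E} {E′} s low
... | inj₁ eq = inj₁ (cong₂ _∷_ (sym (Step.unmoved s j j≢)) eq)
... | inj₂ e∈ = inj₂ (undo-there (Step.unmoved s j j≢) e∈)

-- Reachable columns and backward search

start : GraveDiagram 9
start = initial u

-- R is meant to contain, for each column, the configurations that it can reach, and M
-- the images under lowest of those of column 8.
module Reach (R : Vec (StateSet 1) 9) (M : StateSet 1) where

  open DecMembership (_≟ᵛ_ {9}) using (_∈?_)

  -- The second conjunct tests, for one configuration of column 8, that no move takes its lowest
  -- occupied cell downwards.
  lowerMarker : State 1 → Bool
  lowerMarker (c ∷ []) =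
    member [ lowest c ] M ∧ all (λ c′ → does (lowest c ∈? lowerings (lowest c′))) (moves c)

  startsAt closedAt : Fin 9 → Bool
  startsAt j = member [ column start j ] (lookup R j)
  closedAt j = closed advance (const true) (lookup R j)

  valid : Bool
  valid = all startsAt (List.allFin 9) ∧ all closedAt (List.allFin 9)
          ∧ every lowerMarker (lookup R 7F)

  -- Cuts the backward search off at states with a column, or a marker, outside the precomputed
  -- sets.
  keep : ∀ {m} → Vec (Fin 9) m → State (suc m) → Bool
  keep []       (d ∷ []) = member [ d ] M
  keep (j ∷ js) (c ∷ cs) = member [ c ] (lookup R j) ∧ keep js cs

  Reachable : GraveDiagram 9 → Set
  Reachable E = ∀ j → member [ column E j ] (lookup R j) ≡ true

  module Valid (v : valid ≡ true) where

    reachable-start : Reachable start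
    reachable-start j = all-∈ startsAt (∧-conicalˡ _ _ v) (∈-allFin j)

    closedAt-true : ∀ j → closedAt j ≡ true
    closedAt-true j =
      all-∈ closedAt (∧-conicalˡ _ _ (∧-conicalʳ (all startsAt (List.allFin 9)) _ v)) (∈-allFin j)

    reachable-step : ∀ {E E′} → Reachable E → Step E E′ → Reachable E′
    reachable-step {E} {E′} r st j with j ≟ Step.col st
    ... | yes refl = closed-next advance (const true) (lookup R j) (closedAt-true j) (r j)
                       (∈-map⁺ [_] (∈-moves (Step.moved st))) refl
    ... | no j≢    = trans (cong (λ c → member [ c ] (lookup R j)) (Step.unmoved st j j≢)) (r j)

    reachable : ∀ {E E′} → Reachable E → Star _⟶_ E E′ → Reachable E′
    reachable r ε = r
    reachable {E} r (_◅_ {j = F} t ts) = reachable {F} (reachable-step {E} {F} r (step t)) ts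

    marker : ∀ E → Reachable E → lowerMarker [ column E 7F ] ≡ true
    marker E r = every-member lowerMarker [ column E 7F ] (lookup R 7F)
      (∧-conicalʳ (all closedAt (List.allFin 9)) _
        (∧-conicalʳ (all startsAt (List.allFin 9)) _ v)) (r 7F)

    keep-columns : ∀ E {m} (js : Vec (Fin 9) m) → Reachable E → keep js (columns js E) ≡ true
    keep-columns E []       r = ∧-conicalˡ _ _ (marker E r)
    keep-columns E (j ∷ js) r = cong₂ _∧_ (r j) (keep-columns E js r)

    descends : ∀ E E′ {i} → Reachable E → ColumnMove i (column E 7F) (column E′ 7F) →
               lowest (column E 7F) ∈ lowerings (lowest (column E′ 7F))
    descends E E′ r m with lowest (column E 7F) ∈? lowerings (lowest (column E′ 7F))
                         | all-∈ (λ c′ → does (lowest (column E 7F) ∈? lowerings (lowest c′)))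
                             (∧-conicalʳ (member [ lowest (column E 7F) ] M) _ (marker E r))
                             (∈-moves m)
    -- The case `no` cannot occur: the second value would prove `false ≡ true`.
    ... | yes l∈ | _ = l∈

    -- Membership in a set closed under `undo` passes from the end of a path to its beginning: every
    -- diagram on the way is reachable, so `keep` rejects none of their states.
    backwards : ∀ {m} {js : Vec (Fin 9) m} (S : StateSet (suc m)) →
      AllPairs _<_ js → All (_< (Fin 9 ∋ 7F)) js → closed (undo m) (keep js) S ≡ true →
      ∀ {E E′} → Reachable E → Star _⟶_ E E′ →
      member (columns js E′) S ≡ true → member (columns js E) S ≡ true
    backwards S asc <7 cl r ε e∈ = e∈
    backwards {m} {js} S asc <7 cl {E} {E′} r (_◅_ {j = F} t ts) e∈
      with backwards S asc <7 cl {F} {E′} (reachable-step {E} {F} r (step t)) ts e∈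
         | columns-step asc <7 {E} {F} (step t) (descends E F r)
    ... | f∈ | inj₁ eq = trans (cong (λ s → member s S) eq) f∈
    ... | f∈ | inj₂ u∈ = closed-next (undo m) (keep js) S cl f∈ u∈ (keep-columns E js r)

-- Configurations of weight β

isOccupied : Cell → Bool
isOccupied vacant = false
isOccupied _      = true

weights : ∀ {n m} → Vec (Column n) m → Vec ℕ n
weights cs = tabulate λ i → ∣ Vec.map (λ c → isOccupied (lookup c i)) cs ∣

weights-columns : ∀ {n} (E : GraveDiagram n) → wt E ≡ weights (tabulate (column E))
weights-columns E = tabulate-cong λ i → cong (λ p → ∣ p ∣) (occupancy i)
  where
  occupied-cell : ∀ b g → b ∨ g ≡ isOccupied (cell b g)
  occupied-cell true  _     = refl
  occupied-cell false true  = refl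
  occupied-cell false false = refl

  occupancy : ∀ i → lookup (boxes E) i ∪ lookup (ghosts E) i
                    ≡ Vec.map (λ c → isOccupied (lookup c i)) (tabulate (column E))
  occupancy i = lookup-ext λ j →
    trans (lookup-zipWith _∨_ j (lookup (boxes E) i) (lookup (ghosts E) i))
    (trans (occupied-cell (bit (boxes E) i j) (bit (ghosts E) i j))
    (trans (cong isOccupied (sym (lookup∘tabulate (λ i → cellAt E i j) i)))
    (trans (cong (λ c → isOccupied (lookup c i)) (sym (lookup∘tabulate (column E) j)))
           (sym (lookup-map j (λ c → isOccupied (lookup c i)) (tabulate (column E)))))))

full : Column 9 → Bool
full c = all (λ i → isOccupied (lookup c i)) (0F ∷ 1F ∷ 2F ∷ 3F ∷ [])

all-true : ∀ {A : Set} {m} (f : A → Bool) (xs : Vec A m) →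
           Vec.map f xs ≡ ⊤ → All (λ x → f x ≡ true) xs
all-true f []       _  = []
all-true f (x ∷ xs) eq = ∷-injectiveˡ eq ∷ all-true f xs (∷-injectiveʳ eq)

-- The first four entries of `β` equal the number of columns, so no column has a vacancy in these
-- rows.
weights-full : (cs : State 4) → weights cs ≡ β → All (λ c → full c ≡ true) cs
weights-full cs eq = All.map
  (λ (p₀ , p₁ , p₂ , p₃) → cong₂ _∧_ p₀ (cong₂ _∧_ p₁ (cong₂ _∧_ p₂ (cong₂ _∧_ p₃ refl))))
  (All.zip (row 0F refl , All.zip (row 1F refl , All.zip (row 2F refl , row 3F refl))))
  where
  row : ∀ i → lookup β i ≡ 4 → All (λ c → isOccupied (lookup c i) ≡ true) cs
  row i βᵢ = all-true _ cs (∣p∣≡n⇒p≡⊤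
    (trans (sym (lookup∘tabulate (λ i → ∣ Vec.map (λ c → isOccupied (lookup c i)) cs ∣) i))
      (trans (cong (λ α → lookup α i) eq) βᵢ)))

active : Vec (Fin 9) 4
active = 3F ∷ 4F ∷ 5F ∷ 7F ∷ []

idle : List (Fin 9)
idle = 0F ∷ 1F ∷ 2F ∷ 6F ∷ 8F ∷ []

activeColumns : GraveDiagram 9 → State 4
activeColumns E = Vec.map (column E) active

Idle : GraveDiagram 9 → Set
Idle E = ∀ {j} → j ∈ idle → column E j ≡ blank

weights-active : ∀ E → Idle E → wt E ≡ weights (activeColumns E)
weights-active E b = trans (weights-columns E)
  (drop (column E) (b (here refl)) (b (there (here refl))) (b (there (there (here refl))))
        (b (there (there (there (here refl))))) (b (there (there (there (there (here refl)))))))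
  where
  drop : ∀ (c : Fin 9 → Column 9) → c 0F ≡ blank → c 1F ≡ blank → c 2F ≡ blank →
         c 6F ≡ blank → c 8F ≡ blank → weights (tabulate c) ≡ weights (Vec.map c active)
  drop c b₀ b₁ b₂ b₆ b₈ rewrite b₀ | b₁ | b₂ | b₆ | b₈ = refl

active-injective : ∀ {E E′} → Idle E → Idle E′ → activeColumns E ≡ activeColumns E′ → E ≡ E′
active-injective {E} {E′} b b′ eq = column-injective {E = E} {E′} columns≡
  where
  same : ∀ {j} → j ∈ idle → column E j ≡ column E′ j
  same j∈ = trans (b j∈) (sym (b′ j∈))

  columns≡ : ∀ j → column E j ≡ column E′ j
  columns≡ 0F = same (here refl)
  columns≡ 1F = same (there (here refl))
  columns≡ 2F = same (there (there (here refl)))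
  columns≡ 3F = ∷-injectiveˡ eq
  columns≡ 4F = ∷-injectiveˡ (∷-injectiveʳ eq)
  columns≡ 5F = ∷-injectiveˡ (∷-injectiveʳ (∷-injectiveʳ eq))
  columns≡ 6F = same (there (there (there (here refl))))
  columns≡ 7F = ∷-injectiveˡ (∷-injectiveʳ (∷-injectiveʳ (∷-injectiveʳ eq)))
  columns≡ 8F = same (there (there (there (there (here refl)))))

∈-activeColumns : ∀ E F G → Idle E → Idle F → Idle G →
  activeColumns E ∈ activeColumns F ∷ activeColumns G ∷ [] → E ∈ᵥ F ∷ G ∷ []
∈-activeColumns E F G e f g (here eq)         = VecAny.here (active-injective e f eq)
∈-activeColumns E F G e f g (there (here eq)) = VecAny.there (VecAny.here (active-injective e g eq))

-- Sets obtained by closure are used only after checking that they are closed, so this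
-- number need not be justified.
fuel : ℕ
fuel = 100000

columnSets : Vec (StateSet 1) 9
columnSets = tabulate λ j → closure advance (const true) fuel ([ column start j ] ∷ []) empty

keys : ∀ {A : Set} {n} → Trie A n → List (Column n)
keys none         = []
keys (leaf _)     = [] ∷ []
keys (node v b g) =
  List.map (vacant ∷_) (keys v) ++ List.map (box ∷_) (keys b) ++ List.map (ghost ∷_) (keys g)

markerSet : StateSet 1 → StateSet 1
markerSet S = List.foldr (λ c → adjoin [ lowest c ]) empty (keys S)

β? : (cs : State 4) → Dec (weights cs ≡ β)
β? cs = ≡-dec ℕ._≟_ (weights cs) β

βFinals : Vec (StateSet 1) 9 → List (State 4)
βFinals R = filterᵇ (λ cs → does (β? cs)) (product (Vec.map (lookup R) active))
  where
  product : ∀ {m} → Vec (StateSet 1) m → List (State m)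
  product []       = [] ∷ []
  -- Filtering each column by `full` beforehand keeps the product small; the filter on `β?` then
  -- settles the remaining rows.
  product (S ∷ Ss) = cartesianProductWith _∷_ (filterᵇ full (keys S)) (product Ss)

js₂ : Vec (Fin 9) 2
js₂ = 4F ∷ 5F ∷ []

js₃ : Vec (Fin 9) 3
js₃ = 3F ∷ 4F ∷ 5F ∷ []

marked : State 4 → State 4
marked (a ∷ b ∷ c ∷ d ∷ []) = a ∷ b ∷ c ∷ lowest d ∷ []

-- The backward closure of the unwanted final states `bad`; a path can end in it only if it also
-- starts in it.
trap : Vec (StateSet 1) 9 → StateSet 1 → ∀ {m} → Vec (Fin 9) m → List (State (suc m)) →
       StateSet (suc m)
trap R M js bad = closure (undo _) (Reach.keep R M js) fuel bad empty

-- The final configurations with a ghost in row 4 of column 5 are already excluded by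
-- looking at the columns 5, 6, 8; the search for the other ones needs column 4 as well.
ghostIn₄₅ : State 4 → Bool
ghostIn₄₅ cs = does (lookup (lookup cs 1F) 3F ≟ᶜ ghost)

trap₂ : Vec (StateSet 1) 9 → StateSet 1 → List (State 4) → StateSet 3
trap₂ R M bad = trap R M js₂ (List.map (Vec.tail ∘ marked) (filterᵇ ghostIn₄₅ bad))

trap₃ : Vec (StateSet 1) 9 → StateSet 1 → List (State 4) → StateSet 4
trap₃ R M bad = trap R M js₃ (List.map marked (filterᵇ (not ∘ ghostIn₄₅) bad))

_≟ˢ_ : ∀ {m} → DecidableEquality (State m)
_≟ˢ_ = ≡-dec _≟ᵛ_

from-does : ∀ {A : Set} (a? : Dec A) → does a? ≡ true → A
from-does (yes a) _ = a

-- Certificate and classification of the final configurations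

module Classify (R : Vec (StateSet 1) 9) (M : StateSet 1) (S₂ : StateSet 3) (S₃ : StateSet 4)
                (good : List (State 4)) where

  open Reach R M
  open DecMembership (_≟ˢ_ {4}) using (_∈?_)

  avoidable : ∀ {m} → Vec (Fin 9) m → StateSet (suc m) → Bool
  avoidable js S = closed (undo _) (keep js) S ∧ not (member (columns js start) S)

  idleAt : Fin 9 → Bool
  idleAt j = every (λ s → does (s ≟ˢ [ blank ])) (lookup R j)

  -- A nested traversal of the product of the column sets that drops a column which is not full
  -- before going on to the next.
  everyFull : ∀ {m} → Vec (Fin 9) m → (State m → Bool) → Bool
  everyFull []       f = f []
  everyFull (j ∷ js) f =
    every (λ s → full (Vec.head s) ⇒ everyFull js (f ∘ (Vec.head s ∷_))) (lookup R j)

  explained : State 4 → Bool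
  explained cs = does (β? cs) ⇒ not (member (Vec.tail (marked cs)) S₂) ⇒ not (member (marked cs) S₃)
    ⇒ does (cs ∈? good)

  -- The sets are arbitrary parameters here, so soundness rests on this Boolean alone and not on how
  -- they were computed.
  certificate : Bool
  certificate =
    valid ∧ avoidable js₂ S₂ ∧ avoidable js₃ S₃ ∧ all idleAt idle ∧ everyFull active explained

  everyFull-true : ∀ {m} E (js : Vec (Fin 9) m) f → Reachable E → everyFull js f ≡ true →
    All (λ c → full c ≡ true) (Vec.map (column E) js) → f (Vec.map (column E) js) ≡ true
  everyFull-true E []       f r p _ = p
  everyFull-true E (j ∷ js) f r p (fⱼ ∷ fs) = everyFull-true E js (f ∘ (column E j ∷_)) r
    (⇒-elim (every-member (λ s → full (Vec.head s) ⇒ everyFull js (f ∘ (Vec.head s ∷_)))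
              [ column E j ] (lookup R j) p (r j)) fⱼ) fs

  module Certified (cert : certificate ≡ true) where

    valid-true : valid ≡ true
    valid-true = ∧-conicalˡ _ _ cert

    open Valid valid-true

    rest₁ = ∧-conicalʳ valid _ cert
    rest₂ = ∧-conicalʳ (avoidable js₂ S₂) _ rest₁
    rest₃ = ∧-conicalʳ (avoidable js₃ S₃) _ rest₂

    avoidable₂ : avoidable js₂ S₂ ≡ true
    avoidable₂ = ∧-conicalˡ _ _ rest₁

    avoidable₃ : avoidable js₃ S₃ ≡ true
    avoidable₃ = ∧-conicalˡ _ _ rest₂

    idleAt-true : all idleAt idle ≡ true
    idleAt-true = ∧-conicalˡ _ _ rest₃

    allExplained : everyFull active explained ≡ true
    allExplained = ∧-conicalʳ (all idleAt idle) _ rest₃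

    idle-blank : ∀ E → Reachable E → Idle E
    idle-blank E r {j} j∈ = ∷-injectiveˡ (from-does ([ column E j ] ≟ˢ [ blank ])
      (every-member (λ s → does (s ≟ˢ [ blank ])) [ column E j ] (lookup R j)
        (all-∈ idleAt idleAt-true j∈) (r j)))

    avoid : ∀ {m} {js : Vec (Fin 9) m} S → AllPairs _<_ js → All (_< (Fin 9 ∋ 7F)) js →
            avoidable js S ≡ true → ∀ E → Star _⟶_ start E → not (member (columns js E) S) ≡ true
    avoid {m} {js} S asc <7 av E path with member (columns js E) S in eq
    ... | false = refl
    -- The goal has become `false ≡ true`: the initial state would lie in `S`, which the second half
    -- of `avoidable` denies.
    ... | true  = trans (cong not (sym start∈)) (∧-conicalʳ (closed (undo m) (keep js) S) _ av)
      where
      start∈ : member (columns js start) S ≡ true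
      start∈ = backwards S asc <7 (∧-conicalˡ _ _ av) {start} {E} reachable-start path eq

    classify : ∀ E → Star _⟶_ start E → wt E ≡ β →
               Idle E × activeColumns E ∈ good
    classify E path w = idle-blank E r , from-does (activeColumns E ∈? good)
      (⇒-elim (⇒-elim (⇒-elim
        (everyFull-true E active explained r allExplained (weights-full (activeColumns E) wβ))
        (dec-true (β? (activeColumns E)) wβ))
        (avoid S₂ (from-yes (allPairs? _<?_ js₂)) (from-yes (below? js₂)) avoidable₂ E path))
        (avoid S₃ (from-yes (allPairs? _<?_ js₃)) (from-yes (below? js₃)) avoidable₃ E path))
      where
      below? : ∀ {m} (js : Vec (Fin 9) m) → Dec (All (_< (Fin 9 ∋ 7F)) js)
      below? = All.all? (_<? (Fin 9 ∋ 7F))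

      r : Reachable E
      r = reachable {start} {E} reachable-start path

      wβ : weights (activeColumns E) ≡ β
      wβ = trans (sym (weights-active E (idle-blank E r))) w

module _ (good : List (State 4)) where

  open DecMembership (_≟ˢ_ {4}) using (_∈?_)

  unwanted : Vec (StateSet 1) 9 → List (State 4)
  unwanted R = filterᵇ (λ cs → not (does (cs ∈? good))) (βFinals R)

  -- A separate function so that evaluation shares M and bad.
  certifyWith : Vec (StateSet 1) 9 → StateSet 1 → List (State 4) → Bool
  certifyWith R M bad = Classify.certificate R M (trap₂ R M bad) (trap₃ R M bad) good

  certify : Vec (StateSet 1) 9 → Bool
  certify R = certifyWith R (markerSet (lookup R 7F)) (unwanted R)

  certify-sound : ∀ R → certify R ≡ true → ∀ E → Star _⟶_ start E → wt E ≡ β →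
                  Idle E × activeColumns E ∈ good
  certify-sound R = Classify.Certified.classify R M (trap₂ R M bad) (trap₃ R M bad) good
    where
    M   = markerSet (lookup R 7F)
    bad = unwanted R

-- The two grave diagrams

-- The ordinary and the K-Kohnert move of the box in cell (i , j) to the cell (i′ , j).
data BoxMove (n : ℕ) : Set where
  k K : (i j i′ : Fin n) → BoxMove n

module _ {n : ℕ} where

  occupied? : ∀ (E : GraveDiagram n) i j → Dec (Occupied E i j)
  occupied? E i j = (j ∈ˢ? lookup (boxes E) i) ⊎-dec (j ∈ˢ? lookup (ghosts E) i)

  boxMovable? : ∀ (E : GraveDiagram n) i j i′ → Dec (BoxMovable E i j i′)
  boxMovable? E i j i′ = map′
    (λ (b , r , t , s) → record { isBox = b ; rightmost = r ; target = t ; between = s })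
    (λ m → let open BoxMovable m in isBox , rightmost , target , between)
    (j ∈ˢ? lookup (boxes E) i
     ×-dec all? (λ k → occupied? E i k →-dec k ≤? j)
     ×-dec ((i′ <? i ×-dec ¬? (occupied? E i′ j))
            ×-dec all? (λ r → r <? i →-dec ¬? (occupied? E r j) →-dec r ≤? i′))
     ×-dec all? (λ r → i′ <? r →-dec r ≤? i →-dec occupied? E r j →-dec j ∈ˢ? lookup (boxes E) r))

  disjoint? : ∀ B G → Dec (∀ (c : Fin n × Fin n) → c ∈ᵣ B → ¬ (c ∈ᵣ G))
  disjoint? B G = map′ (λ d (i , j) → d i j) (λ d i j → d (i , j))
    (all? λ i → all? λ j → j ∈ˢ? lookup B i →-dec ¬? (j ∈ˢ? lookup G i))

  -- Legality of every move and disjointness of its result are decided along the way, so a bare list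
  -- of moves yields a path.
  play : ∀ E → List (BoxMove n) → Maybe (∃ (Star _⟶_ E))
  play E [] = just (E , ε)
  play E (k i j i′ ∷ ms)
    with boxMovable? E i j i′ | disjoint? (insert (i′ , j) (remove (i , j) (boxes E))) (ghosts E)
  ... | yes m | yes d with play (grave _ _ d) ms
  ...   | just (E′ , path) = just (E′ , kohnert m refl refl ◅ path)
  ...   | nothing          = nothing
  play E (k i j i′ ∷ ms) | _ | _ = nothing
  play E (K i j i′ ∷ ms)
    with boxMovable? E i j i′
       | disjoint? (insert (i′ , j) (remove (i , j) (boxes E))) (insert (i , j) (ghosts E))
  ... | yes m | yes d with play (grave _ _ d) ms
  ...   | just (E′ , path) = just (E′ , K-kohnert m refl refl ◅ path)
  ...   | nothing          = nothing
  play E (K i j i′ ∷ ms) | _ | _ = nothing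

-- The resulting diagrams differ only in column 4 (counted from 1), occupied in rows 1 to 5: its
-- single ghost is in row 5 for the first and in row 2 for the second.
path₁ path₂ : ∃ (Star _⟶_ start)
path₁ = from-just (play start
  ( k 4F 4F 2F ∷ K 2F 4F 1F ∷ K 1F 4F 0F ∷ K 3F 5F 2F ∷ K 2F 5F 1F
  ∷ K 1F 5F 0F ∷ k 6F 7F 5F ∷ k 5F 7F 4F ∷ k 4F 7F 3F ∷ K 3F 7F 2F
  ∷ K 2F 7F 1F ∷ K 1F 7F 0F ∷ k 6F 3F 2F ∷ k 5F 3F 1F ∷ K 4F 3F 0F ∷ []))
path₂ = from-just (play start
  ( k 4F 4F 2F ∷ k 6F 7F 5F ∷ k 5F 7F 4F ∷ k 6F 3F 2F ∷ k 5F 3F 1F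
  ∷ K 1F 3F 0F ∷ K 2F 4F 1F ∷ K 1F 4F 0F ∷ K 3F 5F 2F ∷ K 2F 5F 1F
  ∷ K 1F 5F 0F ∷ k 4F 7F 3F ∷ K 3F 7F 2F ∷ K 2F 7F 1F ∷ K 1F 7F 0F ∷ []))

E₁ E₂ : GraveDiagram 9
E₁ = proj₁ path₁
E₂ = proj₁ path₂

E₁≢E₂ : E₁ ≢ E₂
E₁≢E₂ eq with () ← cong (λ E → lookup (column E 3F) 1F) eq

wt-E₁ : wt E₁ ≡ β
wt-E₁ = refl

wt-E₂ : wt E₂ ≡ β
wt-E₂ = refl

goodColumns : List (State 4)
goodColumns = activeColumns E₁ ∷ activeColumns E₂ ∷ []

-- Evaluation performs the forward closures, both backward searches and all checks.
certified : certify goodColumns columnSets ≡ true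
certified = refl

card-GKKoh : HasCardinality GKKoh[ u , β ] 2
card-GKKoh = E₁ ∷ E₂ ∷ [] , (E₁≢E₂ ∷ []) ∷ [] ∷ [] , λ E → mk⇔ sound (complete E)
  where
  sound : ∀ {E} → E ∈ᵥ E₁ ∷ E₂ ∷ [] → GKKoh[ u , β ] E
  sound (VecAny.here refl)                = proj₂ path₁ , wt-E₁
  sound (VecAny.there (VecAny.here refl)) = proj₂ path₂ , wt-E₂

  classify : ∀ E → Star _⟶_ start E → wt E ≡ β → Idle E × activeColumns E ∈ goodColumns
  classify = certify-sound goodColumns columnSets certified

  isIdle : ∀ E → GKKoh[ u , β ] E → Idle E
  isIdle E (path , wt-E) = proj₁ (classify E path wt-E)

  complete : ∀ E → GKKoh[ u , β ] E → E ∈ᵥ E₁ ∷ E₂ ∷ []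
  complete E E∈@(path , wt-E) = ∈-activeColumns E E₁ E₂
    -- The two diagrams are themselves reachable of weight `β`, so the classification also shows
    -- that their idle columns are blank.
    (isIdle E E∈) (isIdle E₁ (proj₂ path₁ , wt-E₁)) (isIdle E₂ (proj₂ path₂ , wt-E₂))
    (proj₂ (classify E path wt-E))

proposition3p9 : HasCardinality GKKoh[ u , β ] 2 × HasCardinality PD[ u , β ] 3
proposition3p9 = card-GKKoh , card-PD
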